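{- There exists a binary linear $[4096,772,1024]$ code, and there exists a lattice of dimension $4096$ with center density at least $2^{11529}$.
   Context: A binary linear $[N,k,d]$ code is a $k$-dimensional subspace of ${\bf F}_2^N$ with minimum nonzero Hamming weight $d$. For a lattice ${\bf L}$ of rank $r$ with shortest nonzero vector length $\lambda$ and volume $\mathrm{Vol}({\bf L})$ (square root of the Gram determinant), the center density is $(\lambda/2)^r/\mathrm{Vol}({\bf L})$. -}

module Defs where

open import Data.Nat as ℕ using (ℕ; zero; suc)
open import Data.Bool using (Bool; true; false; _xor_; _∧_; if_then_else_)
open import Data.Fin using (Fin; zero; suc; toℕ; punchIn)
open import Data.Integer as ℤ using (ℤ; +_; -_; _*_; _+_; _≤_; _<_)
open import Data.Product using (Σ; ∃; _×_; _,_)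
open import Relation.Binary.PropositionalEquality using (_≡_; _≢_)

Word : ℕ → Set
Word N = Fin N → Bool

⊕-sum : ∀ {k} → (Fin k → Bool) → Bool
⊕-sum {zero}  f = false
⊕-sum {suc k} f = f zero xor ⊕-sum (λ i → f (suc i))

encode : ∀ {k N} → (Fin k → Word N) → (Fin k → Bool) → Word N
encode G x j = ⊕-sum (λ i → x i ∧ G i j)

weight : ∀ {N} → Word N → ℕ
weight {zero}  w = 0
weight {suc N} w = (if w zero then 1 else 0) ℕ.+ weight (λ j → w (suc j))

NonzeroWord : ∀ {N} → Word N → Set
NonzeroWord {N} w = ∃ λ (j : Fin N) → w j ≡ true

-- The rows of G span a binary linear [N,k,d] code: the rows are linearly
-- independent (so the span has dimension k) and the minimum nonzero weight
-- of the span is exactly d.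
IsBinaryLinearCode : (N k d : ℕ) → (Fin k → Word N) → Set
IsBinaryLinearCode N k d G =
  ((x : Fin k → Bool) → NonzeroWord x → NonzeroWord (encode G x)) ×
  ((x : Fin k → Bool) → NonzeroWord x → d ℕ.≤ weight (encode G x)) ×
  (∃ λ (x : Fin k → Bool) → NonzeroWord x × weight (encode G x) ≡ d)

Σℤ : ∀ {n} → (Fin n → ℤ) → ℤ
Σℤ {zero}  f = + 0
Σℤ {suc n} f = f zero + Σℤ (λ i → f (suc i))

sign : ℕ → ℤ
sign zero          = + 1
sign (suc zero)    = - (+ 1)
sign (suc (suc n)) = sign n

det : ∀ {n} → (Fin n → Fin n → ℤ) → ℤ
det {zero}  M = + 1
det {suc n} M =
  Σℤ (λ j → sign (toℕ j) * M zero j * det (λ r c → M (suc r) (punchIn j c)))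

gram : ∀ {r n} → (Fin r → Fin n → ℤ) → Fin r → Fin r → ℤ
gram B i i′ = Σℤ (λ j → B i j * B i′ j)

latticeVec : ∀ {r n} → (Fin r → Fin n → ℤ) → (Fin r → ℤ) → Fin n → ℤ
latticeVec B c j = Σℤ (λ i → c i * B i j)

normSq : ∀ {n} → (Fin n → ℤ) → ℤ
normSq v = Σℤ (λ j → v j * v j)

NonzeroCoeffs : ∀ {r} → (Fin r → ℤ) → Set
NonzeroCoeffs {r} c = ∃ λ (i : Fin r) → c i ≢ + 0

{-# OPTIONS --safe #-}

-- Both halves are first-moment arguments, made constructive by choosing the parity checks of the
-- object one at a time so that the total weight of the surviving bad vectors drops to its average.
--
-- Code: the Gilbert–Varshamov bound.  A word x gets weight 3 ^ (4096 - |x|); the weights of all words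
-- add up to 4 ^ 4096, and r = 4096 - 772 = 3324 random parity checks divide this by 2 ^ r, which is
-- less than the weight 3 ^ 3073 of a single word of Hamming weight 1023.
--
-- Lattice: Construction A, { (z , y) : z ≡ A y mod 31 } with A a random 861 × 3235 matrix.  Here an
-- integer vector x gets weight about 8 ^ (- |x|²), a theta series in place of the weight enumerator.
-- It follows that the minimal norm is at least 961 = 31², while the Gram determinant is
-- 31 ^ (2 · 861), so the density is close to that of the Minkowski–Hlawka theorem.
module Submission where

open import Defs
open import Data.Bool using (Bool; true; false; T; if_then_else_; _∧_; _xor_)
import Data.Bool.Properties as BoolP
open import Data.Empty using (⊥-elim)
open import Data.Fin using (Fin; zero; suc; toℕ; fromℕ<; punchIn; _↑ˡ_; _↑ʳ_; splitAt)
import Data.Fin.Properties as FinP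
open import Data.List using (List; []; _∷_; _++_; map; length; filter; upTo; allFin; cartesianProductWith)
open import Data.List.Properties using (length-++; length-map; length-tabulate)
open import Data.List.Membership.Propositional using (_∈_)
open import Data.List.Membership.Propositional.Properties using (∈-filter⁺; ∈-cartesianProductWith⁺; ∈-++⁺ˡ; ∈-++⁺ʳ; ∈-map⁺; ∈-upTo⁺)
open import Data.List.Relation.Unary.All as All using (All; []; _∷_)
open import Data.List.Relation.Unary.All.Properties using (all-filter)
open import Data.List.Relation.Unary.AllPairs using ([]; _∷_)
open import Data.List.Relation.Unary.Any using (here; there)
open import Data.List.Relation.Unary.Unique.Propositional using (Unique)
open import Data.List.Relation.Unary.Unique.Propositional.Properties using (allFin⁺)
open import Data.Nat.ListAction using (sum)
open import Data.Product using (∃; _,_; proj₁; proj₂)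
open import Data.Sum using (inj₁; inj₂; [_,_]′)
open import Data.Unit using (tt)
open import Data.Vec using (Vec; []; _∷_; lookup; tabulate)
open import Data.Vec.Properties using (lookup∘tabulate)
import Data.Vec.Functional as F
open import Function using (_∘_; id)
open import Relation.Nullary using (¬_; Dec; yes; no; does)
open import Relation.Nullary.Decidable using (⌊_⌋; toWitness; fromWitness; ¬?; decidable-stable)
open import Relation.Unary using (Decidable)
open import Relation.Binary.PropositionalEquality

-- First moments over finite lists.

module FirstMoment where

  open import Data.Nat
  open import Data.Nat.Properties
  open import Data.Nat.Tactic.RingSolver using (solve-∀)

  private variable
    A B C : Set

  ∑ : List A → (A → ℕ) → ℕ
  ∑ xs f = sum (map f xs)

  ∑-cong : ∀ (xs : List A) {f g : A → ℕ} → (∀ x → f x ≡ g x) → ∑ xs f ≡ ∑ xs g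
  ∑-cong []       f≡g = refl
  ∑-cong (x ∷ xs) f≡g = cong₂ _+_ (f≡g x) (∑-cong xs f≡g)

  ∑-mono : ∀ {xs : List A} {f g : A → ℕ} → All (λ x → f x ≤ g x) xs → ∑ xs f ≤ ∑ xs g
  ∑-mono []       = z≤n
  ∑-mono (p ∷ ps) = +-mono-≤ p (∑-mono ps)

  ∑-const : ∀ (xs : List A) c → ∑ xs (λ _ → c) ≡ length xs * c
  ∑-const []       c = refl
  ∑-const (x ∷ xs) c = cong (c +_) (∑-const xs c)

  ∑-scale : ∀ c (xs : List A) f → ∑ xs (λ x → c * f x) ≡ c * ∑ xs f
  ∑-scale c []       f = sym (*-zeroʳ c)
  ∑-scale c (x ∷ xs) f = trans (cong (c * f x +_) (∑-scale c xs f)) (sym (*-distribˡ-+ c (f x) _))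

  ∑-add : ∀ (xs : List A) f g → ∑ xs (λ x → f x + g x) ≡ ∑ xs f + ∑ xs g
  ∑-add []       f g = refl
  ∑-add (x ∷ xs) f g = trans (cong (f x + g x +_) (∑-add xs f g)) (rearrange (f x) (g x) _ _)
    where
    rearrange : ∀ a b c d → a + b + (c + d) ≡ a + c + (b + d)
    rearrange = solve-∀

  ∑-swap : ∀ (xs : List A) (ys : List B) (f : A → B → ℕ) →
    ∑ xs (λ x → ∑ ys (f x)) ≡ ∑ ys (λ y → ∑ xs (λ x → f x y))
  ∑-swap []       ys f = sym (trans (∑-const ys 0) (*-zeroʳ (length ys)))
  ∑-swap (x ∷ xs) ys f = trans (cong (∑ ys (f x) +_) (∑-swap xs ys f)) (sym (∑-add ys (f x) _))

  ∑-++ : ∀ (xs ys : List A) f → ∑ (xs ++ ys) f ≡ ∑ xs f + ∑ ys f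
  ∑-++ []       ys f = refl
  ∑-++ (x ∷ xs) ys f = trans (cong (f x +_) (∑-++ xs ys f)) (sym (+-assoc (f x) _ _))

  ∑-map : ∀ (g : A → B) xs f → ∑ (map g xs) f ≡ ∑ xs (f ∘ g)
  ∑-map g []       f = refl
  ∑-map g (x ∷ xs) f = cong (f (g x) +_) (∑-map g xs f)

  ∑-filter-≤ : ∀ {P : A → Set} (P? : Decidable P) xs f → ∑ (filter P? xs) f ≤ ∑ xs f
  ∑-filter-≤ P? []       f = z≤n
  ∑-filter-≤ P? (x ∷ xs) f with P? x
  ... | yes _ = +-monoʳ-≤ (f x) (∑-filter-≤ P? xs f)
  ... | no  _ = ≤-trans (∑-filter-≤ P? xs f) (m≤n+m _ (f x))

  ∈⇒≤∑ : ∀ {x} {xs : List A} f → x ∈ xs → f x ≤ ∑ xs f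
  ∈⇒≤∑ f (here refl)           = m≤m+n (f _) _
  ∈⇒≤∑ f (there {x = y} x∈xs) = ≤-trans (∈⇒≤∑ f x∈xs) (m≤n+m _ (f y))

  -- If the head exceeds `b`, dropping it leaves a tail whose average is still at most `b`; a single
  -- remaining entry above `b` would contradict the bound.
  ∑-average : ∀ (xs : List A) f b → 0 < length xs → ∑ xs f ≤ length xs * b → ∃ λ x → f x ≤ b
  ∑-average (x ∷ xs) f b _ ∑≤ with f x ≤? b
  ... | yes fx≤b = x , fx≤b
  ∑-average (x ∷ []) f b _ ∑≤ | no fx≰b =
    ⊥-elim (fx≰b (subst₂ _≤_ (+-identityʳ (f x)) (+-identityʳ b) ∑≤))
  ∑-average (x ∷ y ∷ xs) f b _ ∑≤ | no fx≰b = ∑-average (y ∷ xs) f b z<s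
    (+-cancelˡ-≤ b _ _ (≤-trans (+-monoˡ-≤ _ (<⇒≤ (≰⇒> fx≰b))) ∑≤))

  indicator : Bool → ℕ
  indicator b = if b then 1 else 0

  indicator-T : ∀ {b} → T b → indicator b ≡ 1
  indicator-T {true} _ = refl

  count : List A → (A → Bool) → ℕ
  count xs h = ∑ xs (indicator ∘ h)

  count-unique : ∀ {xs : List A} (h : A → Bool) → Unique xs →
    (∀ x y → T (h x) → T (h y) → x ≡ y) → count xs h ≤ 1
  count-unique h [] inj = z≤n
  count-unique {xs = x ∷ xs} h (x≢ ∷ unique) inj with h x in hx
  ... | false = count-unique h unique inj
  ... | true  = s≤s (≤-reflexive (none xs x≢))
    where
    none : ∀ ys → All (x ≢_) ys → count ys h ≡ 0
    none []       []           = refl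
    none (y ∷ ys) (x≢y ∷ x≢ys) with h y in hy
    ... | false = none ys x≢ys
    ... | true  = ⊥-elim (x≢y (inj x y (subst T (sym hx) _) (subst T (sym hy) _)))

  -- The method of conditional expectations, with averages scaled by `length ωs` to stay in ℕ. Each
  -- check is passed by `x` with probability at most 1/p, so on average over `ωs` at most 1/p of the
  -- weight survives. An outcome no worse than average is fixed, and everything failing it gets
  -- weight zero. An `x` passing all `r` checks keeps its full weight `f x`.
  choose-constraints : ∀ {X Ω : Set} (xs : List X) (ωs : List Ω) p → 0 < length ωs →
    ∀ r (hit : Fin r → X → Ω → Bool) (f : X → ℕ) →
    (∀ c → All (λ x → p * count ωs (hit c x) ≤ length ωs) xs) →
    ∃ λ (ω : Fin r → Ω) → ∀ {x} → x ∈ xs → (∀ c → T (hit c x (ω c))) → p ^ r * f x ≤ ∑ xs f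
  choose-constraints xs ωs p ωs≢[] zero hit f rare =
    (λ ()) , λ x∈xs _ → ≤-trans (≤-reflexive (*-identityˡ _)) (∈⇒≤∑ f x∈xs)
  choose-constraints {X} xs ωs p ωs≢[] (suc r) hit f rare = ω , bound
    where
    survivor : _ → X → ℕ
    survivor ω x = indicator (hit zero x ω) * f x
    shuffle : ∀ p i f → p * (i * f) ≡ f * (p * i)
    shuffle = solve-∀
    total : ∑ ωs (λ ω → p * ∑ xs (survivor ω)) ≤ length ωs * ∑ xs f
    total = begin
      ∑ ωs (λ ω → p * ∑ xs (survivor ω))
        ≡⟨ ∑-scale p ωs _ ⟩
      p * ∑ ωs (λ ω → ∑ xs (survivor ω))
        ≡⟨ cong (p *_) (∑-swap ωs xs survivor) ⟩
      p * ∑ xs (λ x → ∑ ωs (λ ω → survivor ω x))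
        ≡⟨ ∑-scale p xs _ ⟨
      ∑ xs (λ x → p * ∑ ωs (λ ω → survivor ω x))
        ≡⟨ ∑-cong xs (λ x → cong (p *_) (trans (∑-cong ωs λ ω → *-comm _ (f x)) (∑-scale (f x) ωs _))) ⟩
      ∑ xs (λ x → p * (f x * count ωs (hit zero x)))
        ≤⟨ ∑-mono (All.map (λ {x} rare-x → subst₂ _≤_
             (trans (cong (f x *_) (*-comm p _)) (trans (sym (*-assoc (f x) _ p)) (*-comm _ p)))
             (*-comm (f x) _) (*-monoʳ-≤ (f x) rare-x)) (rare zero)) ⟩
      ∑ xs (λ x → length ωs * f x)
        ≡⟨ ∑-scale (length ωs) xs f ⟩
      length ωs * ∑ xs f ∎
      where open ≤-Reasoning
    first = ∑-average ωs _ _ ωs≢[] total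
    -- The rarity hypothesis does not mention the weight, so it survives the replacement of `f` by
    -- `survivor`.
    rest = choose-constraints xs ωs p ωs≢[] r (hit ∘ suc) (survivor (proj₁ first)) (rare ∘ suc)
    ω : Fin (suc r) → _
    ω = proj₁ first F.∷ proj₁ rest
    bound : ∀ {x} → x ∈ xs → (∀ c → T (hit c x (ω c))) → p ^ suc r * f x ≤ ∑ xs f
    bound {x} x∈xs hits = begin
      p ^ suc r * f x
        ≡⟨ *-assoc p (p ^ r) (f x) ⟩
      p * (p ^ r * f x)
        ≡⟨ cong (λ z → p * (p ^ r * z)) (*-identityˡ (f x)) ⟨
      p * (p ^ r * (1 * f x))
        ≡⟨ cong (λ z → p * (p ^ r * (z * f x))) (indicator-T (hits zero)) ⟨
      p * (p ^ r * survivor (proj₁ first) x)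
        ≤⟨ *-monoʳ-≤ p (proj₂ rest x∈xs (hits ∘ suc)) ⟩
      p * ∑ xs (survivor (proj₁ first))
        ≤⟨ proj₂ first ⟩
      ∑ xs f ∎
      where open ≤-Reasoning

  -- Product weights on vectors and random inner products.

  vecs : List A → ∀ n → List (Vec A n)
  vecs ds zero    = [] ∷ []
  vecs ds (suc n) = cartesianProductWith _∷_ ds (vecs ds n)

  tabulate-∈-vecs : ∀ {ds : List A} {n} (v : Fin n → A) → (∀ i → v i ∈ ds) → tabulate v ∈ vecs ds n
  tabulate-∈-vecs {n = zero}  v v∈ds = here refl
  tabulate-∈-vecs {n = suc n} v v∈ds =
    ∈-cartesianProductWith⁺ _∷_ (v∈ds zero) (tabulate-∈-vecs (v ∘ suc) (v∈ds ∘ suc))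

  ∑-cartesianProductWith : ∀ (g : A → B → C) xs ys f →
    ∑ (cartesianProductWith g xs ys) f ≡ ∑ xs (λ x → ∑ ys (λ y → f (g x y)))
  ∑-cartesianProductWith g []       ys f = refl
  ∑-cartesianProductWith g (x ∷ xs) ys f =
    trans (∑-++ (map (g x) ys) _ f) (cong₂ _+_ (∑-map (g x) ys f) (∑-cartesianProductWith g xs ys f))

  length-vecs : ∀ (ds : List A) n → length (vecs ds n) ≡ length ds ^ n
  length-vecs ds zero    = refl
  length-vecs ds (suc n) = trans (go ds) (cong (length ds *_) (length-vecs ds n))
    where
    go : ∀ es → length (cartesianProductWith Vec._∷_ es (vecs ds n)) ≡ length es * length (vecs ds n)
    go []       = refl
    go (e ∷ es) = trans (length-++ (map (e ∷_) (vecs ds n)))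
                        (cong₂ _+_ (length-map (e ∷_) (vecs ds n)) (go es))

  ∏ : ∀ {n} → (Fin n → ℕ) → ℕ
  ∏ = F.foldr _*_ 1

  -- Distributivity: expanding the power of the one-letter sum gives one product for each vector.
  ∑-vecs : ∀ (ds : List A) (w : A → ℕ) n → ∑ (vecs ds n) (λ x → ∏ (w ∘ lookup x)) ≡ ∑ ds w ^ n
  ∑-vecs ds w zero    = refl
  ∑-vecs ds w (suc n) = begin
    ∑ (vecs ds (suc n)) (λ x → ∏ (w ∘ lookup x))
      ≡⟨ ∑-cartesianProductWith _∷_ ds (vecs ds n) _ ⟩
    ∑ ds (λ d → ∑ (vecs ds n) (λ x → w d * ∏ (w ∘ lookup x)))
      ≡⟨ ∑-cong ds (λ d → trans (∑-scale (w d) (vecs ds n) _)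
                          (trans (cong (w d *_) (∑-vecs ds w n)) (*-comm (w d) _))) ⟩
    ∑ ds (λ d → ∑ ds w ^ n * w d)
      ≡⟨ trans (∑-scale (∑ ds w ^ n) ds w) (*-comm (∑ ds w ^ n) _) ⟩
    ∑ ds w ^ suc n ∎
    where open ≡-Reasoning

  ∑ᶠ : ∀ {n} → (Fin n → ℕ) → ℕ
  ∑ᶠ = F.foldr _+_ 0

  -- Vectors of small size are heavy: the letterwise bounds `w ≥ W · b ^ (- s)` are multiplied, with
  -- the negative power moved across to stay in ℕ.
  ∏-bound : ∀ {n} b W (w s : Fin n → ℕ) → (∀ i → W ≤ w i * b ^ s i) → W ^ n ≤ ∏ w * b ^ ∑ᶠ s
  ∏-bound {zero}  b W w s W≤ = ≤-refl
  ∏-bound {suc n} b W w s W≤ = begin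
    W * W ^ n
      ≤⟨ *-mono-≤ (W≤ zero) (∏-bound b W (w ∘ suc) (s ∘ suc) (W≤ ∘ suc)) ⟩
    w zero * b ^ s zero * (∏ (w ∘ suc) * b ^ ∑ᶠ (s ∘ suc))
      ≡⟨ rearrange (w zero) (b ^ s zero) (∏ (w ∘ suc)) (b ^ ∑ᶠ (s ∘ suc)) ⟩
    w zero * ∏ (w ∘ suc) * (b ^ s zero * b ^ ∑ᶠ (s ∘ suc))
      ≡⟨ cong (w zero * ∏ (w ∘ suc) *_) (^-distribˡ-+-* b (s zero) _) ⟨
    ∏ w * b ^ ∑ᶠ s ∎
    where
    open ≤-Reasoning
    rearrange : ∀ a b c d → a * b * (c * d) ≡ a * c * (b * d)
    rearrange = solve-∀

  -- The three types are kept apart because the code takes all of them to be `Bool`, while the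
  -- lattice draws coefficients from `Fin p` and forms inner products in ℤ.
  module Dot {S C Y : Set} (_∙_ : S → S → S) (ε : S) (_·_ : Y → C → S)
             (assoc : ∀ x y z → (x ∙ y) ∙ z ≡ x ∙ (y ∙ z)) (identityˡ : ∀ x → ε ∙ x ≡ x) where

    dot : ∀ {k} → (Fin k → Y) → (Fin k → C) → S
    dot y a = F.foldr _∙_ ε (λ i → y i · a i)

    -- Here `s` and `t` stand for the terms of the inner product before and after the coordinate
    -- `y`.
    Separates : (S → Bool) → Y → Set
    Separates h y = ∀ s t c c′ → T (h (s ∙ ((y · c) ∙ t))) → T (h (s ∙ ((y · c′) ∙ t))) → c ≡ c′

    -- Once the other coefficients are fixed, the test admits at most one value of the `j`-th, so a
    -- random coefficient vector passes with probability at most 1 / `length cs`.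
    count-dot : ∀ {cs : List C} → Unique cs → ∀ {k} (h : S → Bool) (y : Fin k → Y) j → Separates h (y j) →
      length cs * count (vecs cs k) (h ∘ dot y ∘ lookup) ≤ length (vecs cs k)
    count-dot {cs} unique {suc k} h y zero sep = begin
      length cs * count (vecs cs (suc k)) (h ∘ dot y ∘ lookup)
        ≡⟨ cong (length cs *_) (trans (∑-cartesianProductWith _∷_ cs (vecs cs k) _)
                                      (∑-swap cs (vecs cs k) _)) ⟩
      length cs * ∑ (vecs cs k) (λ a → count cs (λ c → h ((y zero · c) ∙ dot (y ∘ suc) (lookup a))))
        ≤⟨ *-monoʳ-≤ (length cs) (∑-mono (All.universal at-most-one (vecs cs k))) ⟩
      length cs * ∑ (vecs cs k) (λ _ → 1)
        ≡⟨ cong (length cs *_) (trans (∑-const (vecs cs k) 1) (trans (*-identityʳ _) (length-vecs cs k))) ⟩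
      length cs ^ suc k
        ≡⟨ length-vecs cs (suc k) ⟨
      length (vecs cs (suc k)) ∎
      where
      open ≤-Reasoning
      at-most-one : ∀ a → count cs (λ c → h ((y zero · c) ∙ dot (y ∘ suc) (lookup a))) ≤ 1
      at-most-one a = count-unique (λ c → h ((y zero · c) ∙ t)) unique λ c c′ p p′ →
        sep ε t c c′ (subst (T ∘ h) (sym (identityˡ _)) p) (subst (T ∘ h) (sym (identityˡ _)) p′)
        where t = dot (y ∘ suc) (lookup a)
    count-dot {cs} unique {suc k} h y (suc j) sep = begin
      length cs * count (vecs cs (suc k)) (h ∘ dot y ∘ lookup)
        ≡⟨ cong (length cs *_) (∑-cartesianProductWith _∷_ cs (vecs cs k) _) ⟩
      length cs * ∑ cs (λ c → count (vecs cs k) (λ a → h ((y zero · c) ∙ dot (y ∘ suc) (lookup a))))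
        ≡⟨ ∑-scale (length cs) cs _ ⟨
      ∑ cs (λ c → length cs * count (vecs cs k) (λ a → h ((y zero · c) ∙ dot (y ∘ suc) (lookup a))))
        -- The first term is absorbed into the test; this is why `h` is arbitrary and `Separates`
        -- allows a prefix `s`.
        ≤⟨ ∑-mono (All.universal (λ c → count-dot unique (λ s → h ((y zero · c) ∙ s)) (y ∘ suc) j
             (λ s t d d′ p p′ → sep ((y zero · c) ∙ s) t d d′
               (subst (T ∘ h) (sym (assoc _ s _)) p) (subst (T ∘ h) (sym (assoc _ s _)) p′))) cs) ⟩
      ∑ cs (λ c → length (vecs cs k))
        ≡⟨ trans (∑-const cs _) (cong (length cs *_) (length-vecs cs k)) ⟩
      length cs ^ suc k
        ≡⟨ length-vecs cs (suc k) ⟨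
      length (vecs cs (suc k)) ∎
      where open ≤-Reasoning

  -- A surviving vector of size at most `e` would weigh at least W^n / b^e, whereas the chosen
  -- checks allow it at most (∑ ds w)^n / p^r. The predicate `P` singles out the vectors on which
  -- the checks are really random.
  avoid-small : ∀ {D Ω : Set} (ds : List D) (ωs : List Ω) p → 0 < length ωs →
    ∀ {n} {P : Vec D n → Set} → Decidable P → ∀ r (hit : Fin r → Vec D n → Ω → Bool) →
    (∀ c x → P x → p * count ωs (hit c x) ≤ length ωs) →
    ∀ (w s : D → ℕ) b W e → .{{NonZero b}} → (∀ d → W ≤ w d * b ^ s d) →
    b ^ e * ∑ ds w ^ n < W ^ n * p ^ r →
    ∃ λ (ω : Fin r → Ω) → ∀ x → x ∈ vecs ds n → P x → (∀ c → T (hit c x (ω c))) →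
      e < ∑ᶠ (s ∘ lookup x)
  avoid-small ds ωs p ωs≢[] {n} P? r hit rare w s b W e W≤ small = proj₁ chosen , large
    where
    xs = filter P? (vecs ds n)
    f : Vec _ n → ℕ
    f x = ∏ (w ∘ lookup x)
    chosen = choose-constraints xs ωs p ωs≢[] r hit f λ c →
      All.map (λ {x} → rare c x) (all-filter P? (vecs ds n))
    large : ∀ x → x ∈ vecs ds n → _ → (∀ c → T (hit c x (proj₁ chosen c))) → e < ∑ᶠ (s ∘ lookup x)
    large x x∈ Px hits with e <? ∑ᶠ (s ∘ lookup x)
    ... | yes e<s = e<s
    ... | no  e≮s = ⊥-elim (<⇒≱ small (begin
      W ^ n * p ^ r
        ≤⟨ *-monoˡ-≤ (p ^ r) (∏-bound b W (w ∘ lookup x) (s ∘ lookup x) (W≤ ∘ lookup x)) ⟩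
      f x * b ^ ∑ᶠ (s ∘ lookup x) * p ^ r
        ≤⟨ *-monoˡ-≤ (p ^ r) (*-monoʳ-≤ (f x) (^-monoʳ-≤ b (≮⇒≥ e≮s))) ⟩
      f x * b ^ e * p ^ r
        ≡⟨ rearrange (f x) (b ^ e) (p ^ r) ⟩
      b ^ e * (p ^ r * f x)
        ≤⟨ *-monoʳ-≤ (b ^ e) (proj₂ chosen (∈-filter⁺ P? x∈ Px) hits) ⟩
      b ^ e * ∑ xs f
        ≤⟨ *-monoʳ-≤ (b ^ e) (∑-filter-≤ P? (vecs ds n) f) ⟩
      b ^ e * ∑ (vecs ds n) f
        ≡⟨ cong (b ^ e *_) (∑-vecs ds w n) ⟩
      b ^ e * ∑ ds w ^ n ∎))
      where
      open ≤-Reasoning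
      rearrange : ∀ a b c → a * b * c ≡ b * (c * a)
      rearrange = solve-∀

-- The Gilbert-Varshamov bound for a systematic code.

module BinaryCode where

  open FirstMoment
  open import Data.Nat hiding (parity)
  open import Data.Nat.Properties
  open import Data.Product using (Σ)

  ⊕-sum-cong : ∀ {k} {f g : Fin k → Bool} → (∀ i → f i ≡ g i) → ⊕-sum f ≡ ⊕-sum g
  ⊕-sum-cong {zero}  f≡g = refl
  ⊕-sum-cong {suc k} f≡g = cong₂ _xor_ (f≡g zero) (⊕-sum-cong (f≡g ∘ suc))

  ⊕-sum-false : ∀ {k} {f : Fin k → Bool} → (∀ i → f i ≡ false) → ⊕-sum f ≡ false
  ⊕-sum-false {zero}  f≡0 = refl
  ⊕-sum-false {suc k} f≡0 = cong₂ _xor_ (f≡0 zero) (⊕-sum-false (f≡0 ∘ suc))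

  ⊕-sum-foldr : ∀ {k} (f : Fin k → Bool) → ⊕-sum f ≡ F.foldr _xor_ false f
  ⊕-sum-foldr {zero}  f = refl
  ⊕-sum-foldr {suc k} f = cong (f zero xor_) (⊕-sum-foldr (f ∘ suc))

  ⊕-sum-unit : ∀ {k} (x : Fin k → Bool) j → ⊕-sum (λ i → x i ∧ does (i FinP.≟ j)) ≡ x j
  ⊕-sum-unit x zero = trans
    (cong₂ _xor_ (BoolP.∧-identityʳ (x zero)) (⊕-sum-false λ i → BoolP.∧-zeroʳ (x (suc i))))
    (BoolP.xor-identityʳ (x zero))
  ⊕-sum-unit x (suc j) = trans
    (cong (_xor ⊕-sum (λ i → x (suc i) ∧ does (i FinP.≟ j))) (BoolP.∧-zeroʳ (x zero)))
    (⊕-sum-unit (x ∘ suc) j)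

  xor-cancelˡ : ∀ x {y z} → x xor y ≡ x xor z → y ≡ z
  xor-cancelˡ true  eq = BoolP.not-injective eq
  xor-cancelˡ false eq = eq

  xor-cancelʳ : ∀ x {y z} → y xor x ≡ z xor x → y ≡ z
  xor-cancelʳ x {y} {z} eq =
    xor-cancelˡ x (trans (BoolP.xor-comm x y) (trans eq (BoolP.xor-comm z x)))

  weight-∑ᶠ : ∀ {N} (w : Word N) → weight w ≡ ∑ᶠ (indicator ∘ w)
  weight-∑ᶠ {zero}  w = refl
  weight-∑ᶠ {suc N} w = cong (indicator (w zero) +_) (weight-∑ᶠ (w ∘ suc))

  weight-cong : ∀ {N} {v w : Word N} → (∀ j → v j ≡ w j) → weight v ≡ weight w
  weight-cong {zero}  v≡w = refl
  weight-cong {suc N} v≡w = cong₂ _+_ (cong indicator (v≡w zero)) (weight-cong (v≡w ∘ suc))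

  weight-false : ∀ {N} {w : Word N} → (∀ j → w j ≡ false) → weight w ≡ 0
  weight-false {zero}  w≡0 = refl
  weight-false {suc N} w≡0 = cong₂ _+_ (cong indicator (w≡0 zero)) (weight-false (w≡0 ∘ suc))

  weight-split : ∀ r {n} (w : Word (r + n)) →
    weight w ≡ weight (λ c → w (c ↑ˡ n)) + weight (λ j → w (r ↑ʳ j))
  weight-split zero    w = refl
  weight-split (suc r) w =
    trans (cong (indicator (w zero) +_) (weight-split r (w ∘ suc))) (sym (+-assoc (indicator (w zero)) _ _))

  weight-prefix : ∀ {r e} → e ≤ r → weight {r} (λ c → toℕ c <ᵇ e) ≡ e
  weight-prefix {r}     {zero}  z≤n       = weight-false {r} λ _ → refl
  weight-prefix {suc r} {suc e} (s≤s e≤r) = cong suc (weight-prefix e≤r)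

  open Dot _xor_ false _∧_ BoolP.xor-assoc BoolP.xor-identityˡ

  bits : List Bool
  bits = false ∷ true ∷ []

  bits-unique : Unique bits
  bits-unique = ((λ ()) ∷ []) ∷ [] ∷ []

  ∈-bits : ∀ b → b ∈ bits
  ∈-bits false = here refl
  ∈-bits true  = there (here refl)

  -- In the generator matrix (A | I) the first row of A is fixed, not random: the first generator
  -- then has weight exactly suc e, so the minimum distance is attained.
  module SystematicCode (r k e : ℕ) (e≤r : e ≤ r)
                        (small : 3 ^ e * 4 ^ (r + suc k) < 3 ^ (r + suc k) * 2 ^ r) where

    message : Vec Bool (r + suc k) → Fin (suc k) → Bool
    message v i = lookup v (r ↑ʳ i)

    parity : Fin r → (Fin (suc k) → Bool) → (Fin k → Bool) → Bool
    parity c x a = (x zero ∧ (toℕ c <ᵇ e)) xor dot (x ∘ suc) a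

    -- The random part `s` of the parity is a separate argument, giving the test on `dot` that
    -- `count-dot` expects.
    hit? : ∀ c v (s : Bool) → Dec (lookup v (c ↑ˡ suc k) ≡ (message v zero ∧ (toℕ c <ᵇ e)) xor s)
    hit? c v s = _ BoolP.≟ _

    hit : Fin r → Vec Bool (r + suc k) → Vec Bool k → Bool
    hit c v a = ⌊ hit? c v (dot (message v ∘ suc) (lookup a)) ⌋

    -- Without a random row in play the checks contain no randomness. The only codewords left out
    -- are zero and the first row, whose weight is known from `weight-first`.
    Involved : Vec Bool (r + suc k) → Set
    Involved v = ∃ λ j → message v (suc j) ≡ true

    rare : ∀ c v → Involved v → 2 * count (vecs bits k) (hit c v) ≤ length (vecs bits k)
    rare c v (j , vj≡true) =
      count-dot bits-unique (λ s → ⌊ hit? c v s ⌋) (message v ∘ suc) j (separates vj≡true)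
      where
      separates : ∀ {y} → y ≡ true → Separates (λ s → ⌊ hit? c v s ⌋) y
      -- With `y` equal to `true` the term `y ∧ d` is `d` itself, so the parity equation determines
      -- it.
      separates refl s t d d′ p p′ = xor-cancelʳ t (xor-cancelˡ s
        (xor-cancelˡ (message v zero ∧ (toℕ c <ᵇ e)) (trans (sym (toWitness p)) (toWitness p′))))

    chosen : ∃ λ (A : Fin r → Vec Bool k) → ∀ v → v ∈ vecs bits (r + suc k) → Involved v →
      (∀ c → T (hit c v (A c))) → e < ∑ᶠ (indicator ∘ lookup v)
    chosen = avoid-small bits (vecs bits k) 2 nonempty (λ v → FinP.any? λ j → _ BoolP.≟ true) r hit rare
      -- A zero bit weighs 3 and a one bit 1. The ratio 3 is (1 - δ) / δ at relative distance δ =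
      -- 1/4: under these weights a typical word has a quarter of its bits set, which makes the
      -- estimate sharpest there.
      (λ b → if b then 1 else 3) indicator 3 3 e (λ { false → ≤-refl ; true → ≤-refl }) small
      where
      nonempty : 0 < length (vecs bits k)
      nonempty = subst (0 <_) (sym (length-vecs bits k)) (m^n>0 2 k)

    A : Fin r → Fin k → Bool
    A c = lookup (proj₁ chosen c)

    row : Fin (suc k) → Fin r → Bool
    row zero    c = toℕ c <ᵇ e
    row (suc i) c = A c i

    G : Fin (suc k) → Word (r + suc k)
    G i j = [ row i , (λ j → does (i FinP.≟ j)) ]′ (splitAt r j)

    encode-parity : ∀ x c → encode G x (c ↑ˡ suc k) ≡ parity c x (A c)
    encode-parity x c rewrite FinP.splitAt-↑ˡ r c (suc k) =
      cong ((x zero ∧ (toℕ c <ᵇ e)) xor_) (⊕-sum-foldr λ i → x (suc i) ∧ A c i)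

    encode-message : ∀ x j → encode G x (r ↑ʳ j) ≡ x j
    encode-message x j rewrite FinP.splitAt-↑ʳ r (suc k) j = ⊕-sum-unit x j

    weight-first : ∀ x → x zero ≡ true → (∀ j → x (suc j) ≡ false) → weight (encode G x) ≡ suc e
    weight-first x x₀ xₛ = begin
      weight (encode G x)
        ≡⟨ weight-split r (encode G x) ⟩
      weight (λ c → encode G x (c ↑ˡ suc k)) + weight (λ j → encode G x (r ↑ʳ j))
        ≡⟨ cong₂ _+_ (weight-cong {r} prefix) (weight-cong (encode-message x)) ⟩
      weight {r} (λ c → toℕ c <ᵇ e) + weight x
        ≡⟨ cong₂ _+_ (weight-prefix e≤r) (cong₂ _+_ (cong indicator x₀) (weight-false xₛ)) ⟩
      e + 1
        ≡⟨ +-comm e 1 ⟩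
      suc e ∎
      where
      open ≡-Reasoning
      prefix : ∀ c → encode G x (c ↑ˡ suc k) ≡ (toℕ c <ᵇ e)
      prefix c = trans (encode-parity x c) (trans
        (cong₂ (λ x₀ s → (x₀ ∧ (toℕ c <ᵇ e)) xor s) x₀
          (trans (sym (⊕-sum-foldr λ i → x (suc i) ∧ A c i))
                 (⊕-sum-false λ i → cong (_∧ A c i) (xₛ i))))
        (BoolP.xor-identityʳ _))

    -- A codeword passes the chosen checks by the very construction of its parity part, so `chosen`
    -- applies to it.
    weight-other : ∀ x j → x (suc j) ≡ true → e < weight (encode G x)
    weight-other x j xj = subst (e <_) weight-v (proj₂ chosen v
      (tabulate-∈-vecs (encode G x) (∈-bits ∘ encode G x))
      (j , trans (message≡ (suc j)) xj) λ c → fromWitness (hits c))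
      where
      v = tabulate (encode G x)
      message≡ : ∀ i → message v i ≡ x i
      message≡ i = trans (lookup∘tabulate (encode G x) (r ↑ʳ i)) (encode-message x i)
      weight-v : ∑ᶠ (indicator ∘ lookup v) ≡ weight (encode G x)
      weight-v = trans (sym (weight-∑ᶠ (lookup v))) (weight-cong (lookup∘tabulate (encode G x)))
      hits : ∀ c → lookup v (c ↑ˡ suc k) ≡ parity c (message v) (A c)
      hits c = begin
        lookup v (c ↑ˡ suc k)     ≡⟨ lookup∘tabulate (encode G x) (c ↑ˡ suc k) ⟩
        encode G x (c ↑ˡ suc k)   ≡⟨ encode-parity x c ⟩
        parity c x (A c)          ≡⟨ cong₂ (λ x₀ s → (x₀ ∧ (toℕ c <ᵇ e)) xor s) (message≡ zero)
                                       (trans (sym (⊕-sum-foldr λ i → message v (suc i) ∧ A c i)) (trans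
                                         (⊕-sum-cong λ i → cong (_∧ A c i) (message≡ (suc i)))
                                         (⊕-sum-foldr λ i → x (suc i) ∧ A c i))) ⟨
        parity c (message v) (A c) ∎
        where open ≡-Reasoning

    weight-≥ : ∀ x → NonzeroWord x → e < weight (encode G x)
    weight-≥ x (i , xi) with FinP.any? (λ j → x (suc j) BoolP.≟ true)
    weight-≥ x (i , xi)     | yes (j , xj) = weight-other x j xj
    weight-≥ x (zero , x₀)  | no none =
      ≤-reflexive (sym (weight-first x x₀ λ j → BoolP.¬-not λ xj → none (j , xj)))
    weight-≥ x (suc j , xj) | no none = ⊥-elim (none (j , xj))

    isCode : IsBinaryLinearCode (r + suc k) (suc k) (suc e) G
    isCode =
      -- The message reappears in the identity block, which gives independence; the first unit
      -- message attains the distance.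
      (λ { x (i , xi) → r ↑ʳ i , trans (encode-message x i) xi }) ,
      weight-≥ ,
      ((true F.∷ λ _ → false) , (zero , refl) , weight-first (true F.∷ λ _ → false) refl λ _ → refl)

  -- The equations let `refl` match the numerals of the theorem with `r + suc k′` and `suc e`.
  code-exists : ∀ {N k d} r k′ e → N ≡ r + suc k′ → k ≡ suc k′ → d ≡ suc e → e ≤ r →
    3 ^ e * 4 ^ N < 3 ^ N * 2 ^ r → Σ (Fin k → Word N) (IsBinaryLinearCode N k d)
  code-exists r k′ e refl refl refl e≤r small = G , isCode
    where open SystematicCode r k′ e e≤r small

-- Multilinearity, alternation and row operations for the first-row expansion.

module Determinant where

  open import Data.Nat as ℕ using (ℕ; zero; suc)
  import Data.Nat.Properties as ℕP
  open import Data.Integer as ℤ using (ℤ; +_; -_; _*_; _+_)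
  import Data.Integer.Properties as ℤP
  open import Data.Integer.Tactic.RingSolver using (solve-∀)
  open F using () renaming (_∷_ to _∷ᵣ_)

  Matrix : ℕ → Set
  Matrix n = Fin n → Fin n → ℤ

  Σℤ-cong : ∀ {n} {f g : Fin n → ℤ} → (∀ i → f i ≡ g i) → Σℤ f ≡ Σℤ g
  Σℤ-cong {zero}  f≡g = refl
  Σℤ-cong {suc n} f≡g = cong₂ _+_ (f≡g zero) (Σℤ-cong (f≡g ∘ suc))

  Σℤ-zero : ∀ {n} {f : Fin n → ℤ} → (∀ i → f i ≡ + 0) → Σℤ f ≡ + 0
  Σℤ-zero {zero}  f≡0 = refl
  Σℤ-zero {suc n} f≡0 = cong₂ _+_ (f≡0 zero) (Σℤ-zero (f≡0 ∘ suc))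

  Σℤ-linear : ∀ {n} a (f g : Fin n → ℤ) → Σℤ (λ i → f i + a * g i) ≡ Σℤ f + a * Σℤ g
  Σℤ-linear {zero}  a f g = sym (trans (ℤP.+-identityˡ _) (ℤP.*-zeroʳ a))
  Σℤ-linear {suc n} a f g =
    trans (cong (ℤ._+_ (f zero + a * g zero)) (Σℤ-linear a (f ∘ suc) (g ∘ suc)))
          (rearrange a (f zero) (g zero) (Σℤ (f ∘ suc)) (Σℤ (g ∘ suc)))
    where
    rearrange : ∀ a x y s t → (x + a * y) + (s + a * t) ≡ (x + s) + a * (y + t)
    rearrange = solve-∀

  Σℤ-scale : ∀ {n} a (f : Fin n → ℤ) → Σℤ (λ i → a * f i) ≡ a * Σℤ f
  Σℤ-scale {zero}  a f = sym (ℤP.*-zeroʳ a)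
  Σℤ-scale {suc n} a f =
    trans (cong (ℤ._+_ (a * f zero)) (Σℤ-scale a (f ∘ suc))) (sym (ℤP.*-distribˡ-+ a _ _))

  sign-suc : ∀ n → sign (suc n) ≡ - sign n
  sign-suc zero          = refl
  sign-suc (suc zero)    = refl
  sign-suc (suc (suc n)) = sign-suc n

  det-cong : ∀ {n} (M N : Matrix n) → (∀ i j → M i j ≡ N i j) → det M ≡ det N
  det-cong {zero}  M N M≡N = refl
  det-cong {suc n} M N M≡N = Σℤ-cong λ j →
    cong₂ _*_ (cong (sign (toℕ j) *_) (M≡N zero j)) (det-cong _ _ λ r c → M≡N (suc r) (punchIn j c))

  -- For the top row the minors agree and the entries are linear; for a lower row the entries agree
  -- and the minors are linear by induction.
  det-row-linear : ∀ {n} (i : Fin n) a {M M′ M″ : Matrix n} →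
    (∀ j → M i j ≡ M′ i j + a * M″ i j) →
    (∀ k → k ≢ i → ∀ j → M k j ≡ M′ k j) →
    (∀ k → k ≢ i → ∀ j → M k j ≡ M″ k j) →
    det M ≡ det M′ + a * det M″
  det-row-linear {suc n} i a {M} {M′} {M″} lin eq′ eq″ =
    trans (Σℤ-cong (term i lin eq′ eq″))
          (Σℤ-linear a (λ j → sign (toℕ j) * M′ zero j * minor M′ j)
                       (λ j → sign (toℕ j) * M″ zero j * minor M″ j))
    where
    minor : Matrix (suc n) → Fin (suc n) → ℤ
    minor N j = det (λ r c → N (suc r) (punchIn j c))
    distrib₀ : ∀ a s x y m → s * (x + a * y) * m ≡ s * x * m + a * (s * y * m)
    distrib₀ = solve-∀
    distrib : ∀ a s x y z → s * x * (y + a * z) ≡ s * x * y + a * (s * x * z)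
    distrib = solve-∀
    term : ∀ i → (∀ j → M i j ≡ M′ i j + a * M″ i j) →
      (∀ k → k ≢ i → ∀ j → M k j ≡ M′ k j) →
      (∀ k → k ≢ i → ∀ j → M k j ≡ M″ k j) → ∀ j →
      sign (toℕ j) * M zero j * minor M j ≡
      sign (toℕ j) * M′ zero j * minor M′ j + a * (sign (toℕ j) * M″ zero j * minor M″ j)
    term zero lin eq′ eq″ j
      rewrite lin j
            | sym (det-cong (λ r c → M (suc r) (punchIn j c)) (λ r c → M′ (suc r) (punchIn j c))
                            λ r c → eq′ (suc r) (λ ()) (punchIn j c))
            | sym (det-cong (λ r c → M (suc r) (punchIn j c)) (λ r c → M″ (suc r) (punchIn j c))
                            λ r c → eq″ (suc r) (λ ()) (punchIn j c))
      = distrib₀ a (sign (toℕ j)) (M′ zero j) (M″ zero j) (minor M j)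
    term (suc i) lin eq′ eq″ j
      rewrite det-row-linear i a
                {M = λ r c → M (suc r) (punchIn j c)}
                {M′ = λ r c → M′ (suc r) (punchIn j c)}
                {M″ = λ r c → M″ (suc r) (punchIn j c)}
                (lin ∘ punchIn j)
                (λ k k≢i → eq′ (suc k) (k≢i ∘ FinP.suc-injective) ∘ punchIn j)
                (λ k k≢i → eq″ (suc k) (k≢i ∘ FinP.suc-injective) ∘ punchIn j)
            | sym (eq′ zero (λ ()) j) | sym (eq″ zero (λ ()) j)
      = distrib a (sign (toℕ j)) (M zero j) (minor M′ j) (minor M″ j)

  -- The expansion of a determinant along its first two rows u and v; the complementary
  -- minor is an arbitrary function E of the remaining columns.
  expand₂ : ∀ {n} → (u v : Fin (suc (suc n)) → ℤ) → ((Fin n → Fin (suc (suc n))) → ℤ) → ℤ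
  expand₂ u v E = Σℤ λ j → sign (toℕ j) * u j *
    Σℤ λ k → sign (toℕ k) * v (punchIn j k) * E (λ c → punchIn j (punchIn k c))

  -- The column selections to be compared agree only pointwise, so `E` must be known to respect
  -- that.
  Extensional : ∀ {n m} → ((Fin n → Fin m) → ℤ) → Set
  Extensional {n} {m} E = ∀ {f g : Fin n → Fin m} → (∀ c → f c ≡ g c) → E f ≡ E g

  -- Removing two columns other than column 0 leaves a selection that is pointwise the `lift` of a
  -- smaller one.
  lift : ∀ {n m} → (Fin n → Fin m) → Fin (suc n) → Fin (suc m)
  lift f zero    = zero
  lift f (suc c) = suc (f c)

  -- The terms not involving column 0 form an expansion of the same kind of smaller size;
  -- those which do are exchanged when u and v are.
  expand₂-split : ∀ {n} u v (E : (Fin n → Fin (suc (suc n))) → ℤ) →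
    let cross = λ w → Σℤ (λ k → sign (toℕ k) * w (suc k) * E (λ c → suc (punchIn k c)))
        rest  = λ j → Σℤ (λ k → sign (toℕ (suc k)) * v (suc (punchIn j k)) *
                                E (λ c → punchIn (suc j) (punchIn (suc k) c)))
    in expand₂ u v E ≡ u zero * cross v + - v zero * cross u
                  + Σℤ (λ j → sign (toℕ (suc j)) * u (suc j) * rest j)
  expand₂-split u v E = begin
    + 1 * u zero * cross v + Σℤ (λ j → sign (toℕ (suc j)) * u (suc j) * inner j)
      ≡⟨ cong₂ _+_ (cong (_* cross v) (ℤP.*-identityˡ (u zero))) (Σℤ-cong tail) ⟩
    u zero * cross v + Σℤ (λ j → S j + - v zero * (sign (toℕ j) * u (suc j) * E (λ c → suc (punchIn j c))))
      ≡⟨ cong (ℤ._+_ (u zero * cross v)) (Σℤ-linear (- v zero) S (λ j → sign (toℕ j) * u (suc j) * E (λ c → suc (punchIn j c)))) ⟩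
    u zero * cross v + (Σℤ S + - v zero * cross u)
      ≡⟨ rearrange (u zero * cross v) (Σℤ S) (- v zero * cross u) ⟩
    u zero * cross v + - v zero * cross u + Σℤ S ∎
    where
    open ≡-Reasoning
    cross = λ w → Σℤ (λ k → sign (toℕ k) * w (suc k) * E (λ c → suc (punchIn k c)))
    rest = λ j → Σℤ (λ k → sign (toℕ (suc k)) * v (suc (punchIn j k)) *
                           E (λ c → punchIn (suc j) (punchIn (suc k) c)))
    inner = λ j → + 1 * v zero * E (λ c → suc (punchIn j c)) + Σℤ (λ k →
      sign (toℕ (suc k)) * v (suc (punchIn j k)) * E (λ c → punchIn (suc j) (punchIn (suc k) c)))
    S = λ j → sign (toℕ (suc j)) * u (suc j) * rest j
    rearrange : ∀ a b c → a + (b + c) ≡ a + c + b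
    rearrange = solve-∀
    distrib : ∀ s u v e r → - s * u * (+ 1 * v * e + r) ≡ - s * u * r + - v * (s * u * e)
    distrib = solve-∀
    tail : ∀ j → sign (toℕ (suc j)) * u (suc j) * inner j ≡
      S j + - v zero * (sign (toℕ j) * u (suc j) * E (λ c → suc (punchIn j c)))
    tail j rewrite sign-suc (toℕ j) =
      distrib (sign (toℕ j)) (u (suc j)) (v zero) (E (λ c → suc (punchIn j c))) (rest j)

  -- In `expand₂-split` the terms with column 0 change sign visibly. The rest is an expansion with
  -- column 0 removed, where the sign shifts of `j` and `k` cancel, and induction applies.
  expand₂-antisym : ∀ {n} (u v : Fin (suc (suc n)) → ℤ) E → Extensional E →
    expand₂ u v E ≡ - expand₂ v u E
  expand₂-antisym {n} u v E ext =
    trans (expand₂-split u v E)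
    (trans (trans (cong (λ z → u zero * X v + - v zero * X u + z) (core n E ext u v))
                  (rearrange (u zero) (v zero) (X v) (X u) _))
           (cong -_ (sym (expand₂-split v u E))))
    where
    X = λ w → Σℤ (λ k → sign (toℕ k) * w (suc k) * E (λ c → suc (punchIn k c)))
    rearrange : ∀ a b x y s → a * x + - b * y + - s ≡ - (b * y + - a * x + s)
    rearrange = solve-∀
    core : ∀ n (E : (Fin n → Fin (suc (suc n))) → ℤ) → Extensional E → ∀ u v →
      let rest = λ (u v : Fin (suc (suc n)) → ℤ) → Σℤ (λ j → sign (toℕ (suc j)) * u (suc j) * Σℤ (λ k →
                   sign (toℕ (suc k)) * v (suc (punchIn j k)) *
                   E (λ c → punchIn (suc j) (punchIn (suc k) c))))
      in rest u v ≡ - rest v u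
    -- There are only two columns, so no pair avoids column 0 and the inner sum is empty.
    core zero E ext u v = trans (vanish u) (cong -_ (sym (vanish v)))
      where
      vanish : ∀ u → Σℤ (λ j → sign (toℕ (suc j)) * u (suc j) * + 0) ≡ + 0
      vanish u = Σℤ-zero {1} λ j → ℤP.*-zeroʳ (sign (toℕ (suc j)) * u (suc j))
    core (suc n) E ext u v = trans (step u v)
      (trans (expand₂-antisym (u ∘ suc) (v ∘ suc) (E ∘ lift) ext′)
             (cong -_ (sym (step v u))))
      where
      ext′ : Extensional (E ∘ lift)
      ext′ f≡g = ext λ { zero → refl ; (suc c) → cong suc (f≡g c) }
      flip : ∀ s t x y e → - s * x * (- t * y * e) ≡ s * x * (t * y * e)
      flip = solve-∀
      step : ∀ (u v : Fin (suc (suc (suc n))) → ℤ) →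
        Σℤ (λ j → sign (toℕ (suc j)) * u (suc j) * Σℤ (λ k →
          sign (toℕ (suc k)) * v (suc (punchIn j k)) *
          E (λ c → punchIn (suc j) (punchIn (suc k) c)))) ≡
        expand₂ (u ∘ suc) (v ∘ suc) (E ∘ lift)
      step u v = Σℤ-cong λ j →
        trans (sym (Σℤ-scale (sign (toℕ (suc j)) * u (suc j)) (old j)))
        (trans (Σℤ-cong (step′ j)) (Σℤ-scale (sign (toℕ j) * u (suc j)) (new j)))
        where
        old new : ∀ j k → ℤ
        old j k = sign (toℕ (suc k)) * v (suc (punchIn j k)) *
                  E (λ c → punchIn (suc j) (punchIn (suc k) c))
        new j k = sign (toℕ k) * v (suc (punchIn j k)) * E (lift (λ c → punchIn j (punchIn k c)))
        step′ : ∀ j k → sign (toℕ (suc j)) * u (suc j) * old j k ≡ sign (toℕ j) * u (suc j) * new j k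
        step′ j k
          rewrite sign-suc (toℕ j) | sign-suc (toℕ k)
                | ext {λ c → punchIn (suc j) (punchIn (suc k) c)} {lift (λ c → punchIn j (punchIn k c))}
                      (λ { zero → refl ; (suc c) → refl })
          = flip (sign (toℕ j)) (sign (toℕ k)) (u (suc j)) (v (suc (punchIn j k))) _

  det-swap : ∀ {n} {M M′ : Matrix (suc (suc n))} →
    (∀ j → M zero j ≡ M′ (suc zero) j) → (∀ j → M (suc zero) j ≡ M′ zero j) →
    (∀ i j → M (suc (suc i)) j ≡ M′ (suc (suc i)) j) → det M ≡ - det M′
  det-swap {n} {M} {M′} eq₀ eq₁ eq =
    trans (expand₂-antisym (M zero) (M (suc zero)) E E-ext)
          (cong -_ (det-cong (M (suc zero) ∷ᵣ M zero ∷ᵣ λ r → M (suc (suc r))) M′ λ { zero → eq₁ ; (suc zero) → eq₀ ; (suc (suc i)) → eq i }))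
    where
    E : (Fin n → Fin (suc (suc n))) → ℤ
    E f = det (λ r c → M (suc (suc r)) (f c))
    E-ext : Extensional E
    E-ext f≡g = det-cong _ _ λ r c → cong (M (suc (suc r))) (f≡g c)

  i≡-i⇒i≡0 : ∀ {i} → i ≡ - i → i ≡ + 0
  i≡-i⇒i≡0 {+ zero} _ = refl

  -- Equal rows at the top: swapping them negates the determinant without changing it. Otherwise the
  -- swap moves the upper equal row into second place, so that it heads every minor of the new first
  -- row, and each minor vanishes by induction.
  det-alternating : ∀ {n} (i : Fin n) (M : Matrix (suc n)) →
    (∀ j → M zero j ≡ M (suc i) j) → det M ≡ + 0
  det-alternating zero M eq = i≡-i⇒i≡0 (det-swap {M = M} {M} eq (sym ∘ eq) λ _ _ → refl)
  det-alternating (suc i) M eq =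
    trans (det-swap {M = M} {M (suc zero) ∷ᵣ M zero ∷ᵣ λ r → M (suc (suc r))}
             (λ _ → refl) (λ _ → refl) (λ _ _ → refl))
          (cong -_ (Σℤ-zero λ j →
            trans (cong (sign (toℕ j) * M (suc zero) j *_) (det-alternating i (λ r c → (M zero ∷ᵣ λ r → M (suc (suc r))) r (punchIn j c)) (eq ∘ punchIn j)))
                  (ℤP.*-zeroʳ (sign (toℕ j) * M (suc zero) j))))

  -- The multipliers are cleared one at a time from the last row upwards; in `clear`, those with
  -- index at least `t` are already zero.
  det-row-ops : ∀ {n} (a : Fin n → ℤ) (u : Fin (suc n) → ℤ) (R : Fin n → Fin (suc n) → ℤ) →
    det (u ∷ᵣ (λ i j → R i j + a i * u j)) ≡ det (u ∷ᵣ R)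
  det-row-ops {n} a u R = clear n a λ i n≤i → ⊥-elim (ℕP.<⇒≱ (FinP.toℕ<n i) n≤i)
    where
    added : (Fin n → ℤ) → Matrix (suc n)
    added a = u ∷ᵣ (λ i j → R i j + a i * u j)
    clear : ∀ t a → (∀ i → t ℕ.≤ toℕ i → a i ≡ + 0) → det (added a) ≡ det (u ∷ᵣ R)
    clear zero a a≡0 = det-cong (added a) (u ∷ᵣ R) λ
      { zero j → refl
      ; (suc i) j → trans (cong (λ z → R i j + z * u j) (a≡0 i ℕ.z≤n)) (ℤP.+-identityʳ (R i j)) }
    clear (suc t) a a≡0 with t ℕ.<? n
    ... | no t≮n = clear t a λ i t≤i → ⊥-elim (t≮n (ℕP.≤-<-trans t≤i (FinP.toℕ<n i)))
    ... | yes t<n = trans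
      (trans (det-row-linear (suc s) (a s) {added a} {added a′} {M″} at-s off off″)
             (trans (cong (λ z → det (added a′) + a s * z) (det-alternating s M″ λ j → sym (M″-s j)))
                    (trans (cong (λ z → det (added a′) + z) (ℤP.*-zeroʳ (a s))) (ℤP.+-identityʳ _))))
      (clear t a′ a′≡0)
      where
      s = fromℕ< t<n
      a′ : Fin n → ℤ
      a′ i with i FinP.≟ s
      ... | yes _ = + 0
      ... | no  _ = a i
      -- By linearity in row `suc s`, clearing `a s` costs `a s` times this determinant, which is
      -- zero because `u` occurs twice.
      M″ : Matrix (suc n)
      M″ zero = u
      M″ (suc i) with i FinP.≟ s
      ... | yes _ = u
      ... | no  _ = added a (suc i)
      M″-s : ∀ j → M″ (suc s) j ≡ u j
      M″-s j with s FinP.≟ s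
      ... | yes _ = refl
      ... | no s≢s = ⊥-elim (s≢s refl)
      at-s : ∀ j → added a (suc s) j ≡ added a′ (suc s) j + a s * M″ (suc s) j
      at-s j with s FinP.≟ s
      ... | yes _ = cong (_+ a s * u j) (sym (ℤP.+-identityʳ (R s j)))
      ... | no s≢s = ⊥-elim (s≢s refl)
      off : ∀ k → k ≢ suc s → ∀ j → added a k j ≡ added a′ k j
      off zero _ j = refl
      off (suc i) i≢s j with i FinP.≟ s
      ... | yes i≡s = ⊥-elim (i≢s (cong suc i≡s))
      ... | no _ = refl
      off″ : ∀ k → k ≢ suc s → ∀ j → added a k j ≡ M″ k j
      off″ zero _ j = refl
      off″ (suc i) i≢s j with i FinP.≟ s
      ... | yes i≡s = ⊥-elim (i≢s (cong suc i≡s))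
      ... | no _ = refl
      a′≡0 : ∀ i → t ℕ.≤ toℕ i → a′ i ≡ + 0
      a′≡0 i t≤i with i FinP.≟ s
      ... | yes _ = refl
      ... | no i≢s = a≡0 i (ℕP.≤∧≢⇒< t≤i λ t≡i →
        i≢s (FinP.toℕ-injective (trans (sym t≡i) (sym (FinP.toℕ-fromℕ< t<n)))))

  det-zero-column : ∀ {n} (M : Matrix (suc n)) → (∀ i → M i zero ≡ + 0) → det M ≡ + 0
  det-zero-column {n} M M≡0 = Σℤ-zero (term n M M≡0)
    where
    term : ∀ n (M : Matrix (suc n)) → (∀ i → M i zero ≡ + 0) → ∀ j →
      sign (toℕ j) * M zero j * det (λ r c → M (suc r) (punchIn j c)) ≡ + 0
    term n M M≡0 zero rewrite M≡0 zero = refl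
    term (suc n) M M≡0 (suc j) =
      trans (cong (sign (toℕ (suc j)) * M zero (suc j) *_) (det-zero-column (λ r c → M (suc r) (punchIn (suc j) c)) (M≡0 ∘ suc)))
            (ℤP.*-zeroʳ (sign (toℕ (suc j)) * M zero (suc j)))

  -- Every minor but the first retains the zero part of column 0.
  det-first-column : ∀ {n} (M : Matrix (suc n)) → (∀ i → M (suc i) zero ≡ + 0) →
    det M ≡ M zero zero * det (λ r c → M (suc r) (suc c))
  det-first-column {n} M M≡0 =
    trans (cong₂ _+_ (cong (_* D) (ℤP.*-identityˡ (M zero zero))) (Σℤ-zero (vanish n M M≡0)))
          (ℤP.+-identityʳ _)
    where
    D = det (λ r c → M (suc r) (suc c))
    vanish : ∀ n (M : Matrix (suc n)) → (∀ i → M (suc i) zero ≡ + 0) → ∀ j →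
      sign (toℕ (suc j)) * M zero (suc j) * det (λ r c → M (suc r) (punchIn (suc j) c)) ≡ + 0
    vanish (suc n) M M≡0 j =
      trans (cong (sign (toℕ (suc j)) * M zero (suc j) *_) (det-zero-column (λ r c → M (suc r) (punchIn (suc j) c)) M≡0))
            (ℤP.*-zeroʳ (sign (toℕ (suc j)) * M zero (suc j)))

  -- Gram determinants of block triangular bases.

  border : ∀ {n} → ℤ → (Fin n → ℤ) → Matrix n → Matrix (suc n)
  border d a B zero    zero    = d
  border d a B zero    (suc j) = + 0
  border d a B (suc i) zero    = a i
  border d a B (suc i) (suc j) = B i j

  -- The first Gram row is `d` times `v = (d , a)`. Subtracting `a i` times `v` from each later row
  -- leaves `(0 , gram B i)`, so a second factor `d` splits off along column 0.
  det-gram-border : ∀ {n} d (a : Fin n → ℤ) B →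
    det (gram (border d a B)) ≡ d * d * det (gram B)
  det-gram-border {n} d a B = begin
    det (gram (border d a B))
      -- Homogeneity in the first row is linearity with a zero row as the other summand.
      ≡⟨ det-row-linear zero d {gram (border d a B)} {(λ _ → + 0) ∷ᵣ rows} {v ∷ᵣ rows} top off off ⟩
    det ((λ _ → + 0) ∷ᵣ rows) + d * det (v ∷ᵣ rows)
      ≡⟨ cong₂ (λ x y → x + d * y) top-zero (trans (det-cong (v ∷ᵣ rows) _ entries) (det-row-ops a v reduced)) ⟩
    + 0 + d * det (v ∷ᵣ reduced)
      ≡⟨ ℤP.+-identityˡ _ ⟩
    d * det (v ∷ᵣ reduced)
      ≡⟨ cong (d *_) (det-first-column (v ∷ᵣ reduced) λ _ → refl) ⟩
    d * (d * det (gram B))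
      ≡⟨ sym (ℤP.*-assoc d d _) ⟩
    d * d * det (gram B) ∎
    where
    open ≡-Reasoning
    i+0≡0+i : ∀ i → i + + 0 ≡ + 0 + i
    i+0≡0+i = solve-∀
    v : Fin (suc n) → ℤ
    v = d ∷ᵣ a
    rows reduced : Fin n → Fin (suc n) → ℤ
    rows i = gram (border d a B) (suc i)
    reduced i = + 0 ∷ᵣ gram B i
    top-zero : det ((λ _ → + 0) ∷ᵣ rows) ≡ + 0
    top-zero = Σℤ-zero λ j → cong (_* det (λ r c → rows r (punchIn j c))) (ℤP.*-zeroʳ (sign (toℕ j)))
    top : ∀ j → gram (border d a B) zero j ≡ + 0 + d * v j
    top zero = trans (cong (λ z → d * d + z) (Σℤ-zero {f = λ (_ : Fin n) → + 0 * + 0} λ _ → refl))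
      (i+0≡0+i (d * d))
    top (suc i) = trans (cong (λ z → d * a i + z) (Σℤ-zero {f = λ j → + 0 * B i j} λ _ → refl))
      (i+0≡0+i (d * a i))
    off : ∀ {w : Fin (suc n) → ℤ} k → k ≢ zero → ∀ j → gram (border d a B) k j ≡ (w ∷ᵣ rows) k j
    off zero    0≢0 = ⊥-elim (0≢0 refl)
    off (suc i) _ j = refl
    entries : ∀ i j → (v ∷ᵣ rows) i j ≡ (v ∷ᵣ λ i j → reduced i j + a i * v j) i j
    entries zero    j       = refl
    entries (suc i) zero    = trans (cong (λ z → a i * d + z) (Σℤ-zero λ j → ℤP.*-zeroʳ (B i j)))
      (i+0≡0+i (a i * d))
    entries (suc i) (suc j) = ℤP.+-comm (a i * a j) (gram B i j)

-- Construction A with random checks modulo a prime.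

module Lattice where

  open FirstMoment
  open Determinant
  open import Data.Nat as ℕ using (ℕ; zero; suc; s≤s; z≤n; NonZero)
  import Data.Nat.Properties as ℕP
  import Data.Nat.Divisibility as ℕD
  open import Data.Nat.Primality using (Prime; euclidsLemma)
  open import Data.Integer as ℤ using (ℤ; +_; -[1+_]; _*_; _+_; ∣_∣; _-_; _≤_; _<_)
  import Data.Integer.Properties as ℤP
  open import Data.Integer.Divisibility.Signed using (_∣_; divides; _∣?_; ∣⇒∣ᵤ; ∣ᵤ⇒∣; ∣m∣n⇒∣m-n)
  open import Data.Integer.Tactic.RingSolver using (solve-∀)
  open import Data.Product using (Σ; _×_)

  Σℤ-foldr : ∀ {k} (f : Fin k → ℤ) → Σℤ f ≡ F.foldr _+_ (+ 0) f
  Σℤ-foldr {zero}  f = refl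
  Σℤ-foldr {suc k} f = cong (ℤ._+_ (f zero)) (Σℤ-foldr (f ∘ suc))

  square : ℤ → ℕ
  square t = ∣ t ∣ ℕ.* ∣ t ∣

  normSq-∑ᶠ : ∀ {n} (v : Fin n → ℤ) → normSq v ≡ + ∑ᶠ (square ∘ v)
  normSq-∑ᶠ {zero}  v = refl
  normSq-∑ᶠ {suc n} v = cong₂ _+_ (i*i (v zero)) (normSq-∑ᶠ (v ∘ suc))
    where
    i*i : ∀ i → i * i ≡ + square i
    i*i (+ n)    = sym (ℤP.pos-* n n)
    i*i -[1+ n ] = refl

  ≤∑ᶠ : ∀ {n} (f : Fin n → ℕ) i → f i ℕ.≤ ∑ᶠ f
  ≤∑ᶠ f zero    = ℕP.m≤m+n (f zero) _
  ≤∑ᶠ f (suc i) = ℕP.≤-trans (≤∑ᶠ (f ∘ suc) i) (ℕP.m≤n+m _ (f zero))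

  ∑ᶠ-cong : ∀ {n} {f g : Fin n → ℕ} → (∀ i → f i ≡ g i) → ∑ᶠ f ≡ ∑ᶠ g
  ∑ᶠ-cong {zero}  f≡g = refl
  ∑ᶠ-cong {suc n} f≡g = cong₂ ℕ._+_ (f≡g zero) (∑ᶠ-cong (f≡g ∘ suc))

  ∣∧∣i∣<⇒≡0 : ∀ {p i} → + p ∣ i → ∣ i ∣ ℕ.< p → i ≡ + 0
  ∣∧∣i∣<⇒≡0 {p} {i} p∣i ∣i∣<p with ∣ i ∣ in eq
  ... | zero  = ℤP.∣i∣≡0⇒i≡0 eq
  ... | suc n = ⊥-elim (ℕP.<⇒≱ ∣i∣<p (subst (p ℕ.≤_) eq (ℕD.∣⇒≤ {{subst NonZero (sym eq) _}} (∣⇒∣ᵤ p∣i))))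

  -- Built from `border` so that `det-gram-border` covers this block too.
  identity : ∀ k → Matrix k
  identity zero    = λ ()
  identity (suc k) = border (+ 1) (λ _ → + 0) (identity k)

  column : ∀ r {k} → (Fin k → ℤ) → Fin (r ℕ.+ k) → ℤ
  column zero    a i       = a i
  column (suc r) a zero    = + 0
  column (suc r) a (suc i) = column r a i

  -- The matrix ((p I , 0) , (Aᵀ , I)), whose rows span { (z , y) : z ≡ A y mod p }.
  basis : ∀ p r {k} → (Fin r → Fin k → ℤ) → Matrix (r ℕ.+ k)
  basis p zero    {k} A = identity k
  basis p (suc r) A     = border (+ p) (column r (A zero)) (basis p r (A ∘ suc))

  det-gram-identity : ∀ k → det (gram (identity k)) ≡ + 1
  det-gram-identity zero    = refl
  det-gram-identity (suc k) =
    trans (det-gram-border (+ 1) (λ _ → + 0) (identity k)) (cong (+ 1 * + 1 *_) (det-gram-identity k))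

  det-gram-basis : ∀ p r {k} (A : Fin r → Fin k → ℤ) →
    det (gram (basis p r A)) ≡ + (p ℕ.^ r ℕ.* p ℕ.^ r)
  det-gram-basis p zero    {k} A = det-gram-identity k
  det-gram-basis p (suc r) A = begin
    det (gram (basis p (suc r) A))
      ≡⟨ det-gram-border (+ p) (column r (A zero)) (basis p r (A ∘ suc)) ⟩
    + p * + p * det (gram (basis p r (A ∘ suc)))
      ≡⟨ cong (+ p * + p *_) (trans (det-gram-basis p r (A ∘ suc)) (ℤP.pos-* (p ℕ.^ r) _)) ⟩
    + p * + p * (+ (p ℕ.^ r) * + (p ℕ.^ r))
      ≡⟨ rearrange (+ p) (+ (p ℕ.^ r)) ⟩
    (+ p * + (p ℕ.^ r)) * (+ p * + (p ℕ.^ r))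
      ≡⟨ cong (λ z → z * z) (ℤP.pos-* p (p ℕ.^ r)) ⟨
    + (p ℕ.^ suc r) * + (p ℕ.^ suc r)
      ≡⟨ ℤP.pos-* (p ℕ.^ suc r) (p ℕ.^ suc r) ⟨
    + (p ℕ.^ suc r ℕ.* p ℕ.^ suc r) ∎
    where
    open ≡-Reasoning
    rearrange : ∀ x y → x * x * (y * y) ≡ (x * y) * (x * y)
    rearrange = solve-∀

  latticeVec-border-suc : ∀ {n} d (a : Fin n → ℤ) B c j →
    latticeVec (border d a B) c (suc j) ≡ latticeVec B (c ∘ suc) j
  latticeVec-border-suc d a B c j = trans (cong (_+ tail) (ℤP.*-zeroʳ (c zero))) (ℤP.+-identityˡ tail)
    where tail = latticeVec B (c ∘ suc) j

  latticeVec-identity : ∀ k c j → latticeVec (identity k) c j ≡ c j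
  latticeVec-identity (suc k) c zero =
    trans (cong₂ _+_ (ℤP.*-identityʳ (c zero)) (Σℤ-zero λ i → ℤP.*-zeroʳ (c (suc i)))) (ℤP.+-identityʳ _)
  latticeVec-identity (suc k) c (suc j) =
    trans (latticeVec-border-suc (+ 1) (λ _ → + 0) (identity k) c j) (latticeVec-identity k (c ∘ suc) j)

  latticeVec-message : ∀ p r {k} (A : Fin r → Fin k → ℤ) c j →
    latticeVec (basis p r A) c (r ↑ʳ j) ≡ c (r ↑ʳ j)
  latticeVec-message p zero    {k} A c j = latticeVec-identity k c j
  latticeVec-message p (suc r) A c j =
    trans (latticeVec-border-suc (+ p) (column r (A zero)) (basis p r (A ∘ suc)) c (r ↑ʳ j))
          (latticeVec-message p r (A ∘ suc) (c ∘ suc) j)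

  Σℤ-column : ∀ r {k} (c : Fin (r ℕ.+ k) → ℤ) (a : Fin k → ℤ) →
    Σℤ (λ i → c i * column r a i) ≡ Σℤ (λ j → c (r ↑ʳ j) * a j)
  Σℤ-column zero    c a = refl
  Σℤ-column (suc r) c a =
    trans (cong₂ _+_ (ℤP.*-zeroʳ (c zero)) (Σℤ-column r (c ∘ suc) a)) (ℤP.+-identityˡ _)

  -- Check coordinate `i` receives `p` times the coefficient of its own row, which is the quotient,
  -- plus the inner product contributed by the message rows.
  latticeVec-parity : ∀ p r {k} (A : Fin r → Fin k → ℤ) c i →
    + p ∣ latticeVec (basis p r A) c (i ↑ˡ k) - Σℤ (λ j → c (r ↑ʳ j) * A i j)
  latticeVec-parity p (suc r) {k} A c zero = divides (c zero) (trans
    (cong (λ s → c zero * + p + s - t) (Σℤ-column r (c ∘ suc) (A zero)))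
    (cancel (c zero * + p) t))
    where
    t = Σℤ (λ j → c (suc r ↑ʳ j) * A zero j)
    cancel : ∀ x y → x + y - y ≡ x
    cancel = solve-∀
  latticeVec-parity p (suc r) {k} A c (suc i) =
    subst (λ z → + p ∣ z - Σℤ (λ j → c (suc r ↑ʳ j) * A (suc i) j))
      (sym (latticeVec-border-suc (+ p) (column r (A zero)) (basis p r (A ∘ suc)) c (i ↑ˡ k)))
      (latticeVec-parity p r (A ∘ suc) (c ∘ suc) i)

  -- The first row meets only coordinate 0, so the other coordinates kill the remaining
  -- coefficients; coordinate 0 is then `c zero * p`.
  latticeVec-injective : ∀ p .{{_ : NonZero p}} r {k} (A : Fin r → Fin k → ℤ) c →
    (∀ j → latticeVec (basis p r A) c j ≡ + 0) → ∀ i → c i ≡ + 0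
  latticeVec-injective p zero {k} A c v≡0 i = trans (sym (latticeVec-identity k c i)) (v≡0 i)
  latticeVec-injective p (suc r) A c v≡0 = λ { zero → head ; (suc i) → tail i }
    where
    tail : ∀ i → c (suc i) ≡ + 0
    tail = latticeVec-injective p r (A ∘ suc) (c ∘ suc) λ j →
      trans (sym (latticeVec-border-suc (+ p) (column r (A zero)) (basis p r (A ∘ suc)) c j)) (v≡0 (suc j))
    c₀p≡0 : c zero * + p ≡ + 0 * + p
    c₀p≡0 = trans (sym (ℤP.+-identityʳ _))
      (trans (cong (ℤ._+_ (c zero * + p)) (sym (Σℤ-zero λ i → cong (_* column r (A zero) i) (tail i))))
             (v≡0 zero))
    head : c zero ≡ + 0
    head = ℤP.*-cancelʳ-≡ (c zero) (+ 0) (+ p) c₀p≡0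

  -- For p = q + 1, every vector of squared norm below p² has its coordinates in this range, so the
  -- bad vectors form a finite list.
  digits : ℕ → List ℤ
  digits q = map +_ (upTo (suc q)) ++ map -[1+_] (upTo q)

  ∈-digits : ∀ {q t} → ∣ t ∣ ℕ.< suc q → t ∈ digits q
  ∈-digits     {t = + n}      n<p       = ∈-++⁺ˡ (∈-map⁺ +_ (∈-upTo⁺ n<p))
  ∈-digits {q} {t = -[1+ n ]} (s≤s n<q) = ∈-++⁺ʳ (map +_ (upTo (suc q))) (∈-map⁺ -[1+_] (∈-upTo⁺ n<q))

  ∣∸⇒≡ : ∀ {p m n} → n ℕ.< p → m ℕ.≤ n → p ℕD.∣ n ℕ.∸ m → m ≡ n
  ∣∸⇒≡ {p} {m} {n} n<p m≤n p∣n-m with n ℕ.∸ m in eq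
  ... | zero  = ℕP.≤-antisym m≤n (ℕP.m∸n≡0⇒m≤n eq)
  ... | suc d = ⊥-elim (ℕP.<⇒≱ n<p (ℕP.≤-trans (ℕD.∣⇒≤ p∣n-m)
                  (ℕP.≤-trans (ℕP.≤-reflexive (sym eq)) (ℕP.m∸n≤m n m))))

  ∣-difference⇒≡ : ∀ {p m n} → m ℕ.< p → n ℕ.< p → p ℕD.∣ ∣ m ℤ.⊖ n ∣ → m ≡ n
  ∣-difference⇒≡ {p} {m} {n} m<p n<p p∣ with ℕP.≤-total m n
  ... | inj₁ m≤n = ∣∸⇒≡ n<p m≤n (subst (p ℕD.∣_) (ℤP.∣⊖∣-≤ m≤n) p∣)
  ... | inj₂ n≤m = sym (∣∸⇒≡ m<p n≤m (subst (p ℕD.∣_)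
                     (trans (ℤP.∣m⊖n∣≡∣n⊖m∣ m n) (ℤP.∣⊖∣-≤ n≤m)) p∣))

  -- Multiplication by a nonzero residue is injective modulo a prime.
  ∣-product⇒≡ : ∀ {p y m n} → Prime p → ¬ (+ p ∣ y) → m ℕ.< p → n ℕ.< p →
    + p ∣ y * (+ m - + n) → m ≡ n
  ∣-product⇒≡ {p} {y} {m} {n} p-prime p∤y m<p n<p p∣
    with euclidsLemma ∣ y ∣ ∣ + m - + n ∣ p-prime (subst (p ℕD.∣_) (ℤP.abs-* y (+ m - + n)) (∣⇒∣ᵤ p∣))
  ... | inj₁ p∣y   = ⊥-elim (p∤y (∣ᵤ⇒∣ p∣y))
  ... | inj₂ p∣m-n = ∣-difference⇒≡ m<p n<p (subst (λ z → p ℕD.∣ ∣ z ∣) (ℤP.m-n≡m⊖n m n) p∣m-n)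

  square-cancel-< : ∀ {p} t → square t ℕ.< p ℕ.* p → ∣ t ∣ ℕ.< p
  square-cancel-< {p} t t²<p² with ∣ t ∣ ℕ.<? p
  ... | yes t<p = t<p
  ... | no  t≮p = ⊥-elim (ℕP.<⇒≱ t²<p² (ℕP.*-mono-≤ (ℕP.≮⇒≥ t≮p) (ℕP.≮⇒≥ t≮p)))

  ↑-cases : ∀ r {k} {P : Fin (r ℕ.+ k) → Set} → (∀ i → P (i ↑ˡ k)) → (∀ j → P (r ↑ʳ j)) → ∀ j → P j
  ↑-cases r {P = P} left right j with splitAt r j in eq
  ... | inj₁ i  = subst P (FinP.splitAt⁻¹-↑ˡ eq) (left i)
  ... | inj₂ j′ = subst P (FinP.splitAt⁻¹-↑ʳ eq) (right j′)

  module ConstructionA (q : ℕ) (p-prime : Prime (suc q)) (r k e : ℕ) (e<p² : e ℕ.< suc q ℕ.* suc q)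
    (w : ℤ → ℕ) (b W : ℕ) .{{_ : NonZero b}} (W≤ : ∀ t → W ℕ.≤ w t ℕ.* b ℕ.^ square t)
    (small : b ℕ.^ e ℕ.* ∑ (digits q) w ℕ.^ (r ℕ.+ k) ℕ.< W ℕ.^ (r ℕ.+ k) ℕ.* suc q ℕ.^ r) where

    p = suc q

    open Dot {C = Fin p} _+_ (+ 0) (λ y c → y * + toℕ c) ℤP.+-assoc ℤP.+-identityˡ

    message : Vec ℤ (r ℕ.+ k) → Fin k → ℤ
    message v i = lookup v (r ↑ʳ i)

    hit? : ∀ (c : Fin r) v s → Dec (+ p ∣ lookup v (c ↑ˡ k) - s)
    hit? c v s = + p ∣? (lookup v (c ↑ˡ k) - s)

    hit : Fin r → Vec ℤ (r ℕ.+ k) → Vec (Fin p) k → Bool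
    hit c v a = ⌊ hit? c v (dot (message v) (lookup a)) ⌋

    -- If `p` divides the whole message, a vector passing the checks is divisible by `p` throughout,
    -- so it is zero or has squared norm at least p².
    Involved : Vec ℤ (r ℕ.+ k) → Set
    Involved v = ∃ λ j → ¬ (+ p ∣ message v j)

    involved? : ∀ v → Dec (Involved v)
    involved? v = FinP.any? λ j → ¬? (+ p ∣? message v j)

    rare : ∀ c v → Involved v →
      p ℕ.* count (vecs (allFin p) k) (hit c v) ℕ.≤ length (vecs (allFin p) k)
    rare c v (j , p∤y) = subst
      (λ l → l ℕ.* count (vecs (allFin p) k) (hit c v) ℕ.≤ length (vecs (allFin p) k))
      (length-tabulate {n = p} id)
      (count-dot (allFin⁺ p) (λ s → ⌊ hit? c v s ⌋) (message v) j separates)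
      where
      y = message v j
      difference : ∀ z s t x y x′ →
        (z - (s + (y * x′ + t))) - (z - (s + (y * x + t))) ≡ y * (x - x′)
      difference = solve-∀
      separates : Separates (λ s → ⌊ hit? c v s ⌋) y
      -- Subtracting the two checks leaves only `y` times the difference of the coefficients.
      separates s t d d′ h h′ = FinP.toℕ-injective
        (∣-product⇒≡ p-prime p∤y (FinP.toℕ<n d) (FinP.toℕ<n d′)
          (subst (+ p ∣_) (difference (lookup v (c ↑ˡ k)) s t (+ toℕ d) y (+ toℕ d′))
            (∣m∣n⇒∣m-n (toWitness h′) (toWitness h))))

    chosen : ∃ λ (A : Fin r → Vec (Fin p) k) → ∀ v → v ∈ vecs (digits q) (r ℕ.+ k) → Involved v →
      (∀ c → T (hit c v (A c))) → e ℕ.< ∑ᶠ (square ∘ lookup v)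
    chosen = avoid-small (digits q) (vecs (allFin p) k) p nonempty involved? r hit rare w square b W e W≤ small
      where
      nonempty : 0 ℕ.< length (vecs (allFin p) k)
      nonempty = subst (0 ℕ.<_)
        (sym (trans (length-vecs (allFin p) k) (cong (ℕ._^ k) (length-tabulate {n = p} id)))) (ℕP.m^n>0 p k)

    A : Fin r → Fin k → ℤ
    A c i = + toℕ (lookup (proj₁ chosen c) i)

    B : Matrix (r ℕ.+ k)
    B = basis p r A

    -- Assuming norm at most `e`, all coordinates are below `p` in absolute value. An involved
    -- vector is then excluded by `chosen`; otherwise message and parities are multiples of `p`
    -- below `p`, so the vector and its coefficients vanish.
    minimum : ∀ c → NonzeroCoeffs c → + suc e ≤ normSq (latticeVec B c)
    minimum c (i , cᵢ≢0) = subst (+ suc e ≤_) (sym (normSq-∑ᶠ v)) (ℤ.+≤+ e<s)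
      where
      v = latticeVec B c
      x = tabulate v
      lookup-x : ∀ j → lookup x j ≡ v j
      lookup-x = lookup∘tabulate v
      message-x : ∀ j → message x j ≡ c (r ↑ʳ j)
      message-x j = trans (lookup-x (r ↑ʳ j)) (latticeVec-message p r A c j)
      hits : ∀ i → + p ∣ lookup x (i ↑ˡ k) - dot (message x) (lookup (proj₁ chosen i))
      hits i = subst₂ (λ z s → + p ∣ z - s) (sym (lookup-x (i ↑ˡ k)))
        (trans (Σℤ-cong λ j → cong (_* A i j) (sym (message-x j))) (Σℤ-foldr λ j → message x j * A i j))
        (latticeVec-parity p r A c i)
      module Small (s≤e : ∑ᶠ (square ∘ v) ℕ.≤ e) where
        v<p : ∀ j → ∣ v j ∣ ℕ.< p
        v<p j = square-cancel-< (v j) (ℕP.≤-<-trans (ℕP.≤-trans (≤∑ᶠ (square ∘ v) j) s≤e) e<p²)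
        absurd : Dec (Involved x) → e ℕ.< ∑ᶠ (square ∘ v)
        absurd (yes inv) = subst (e ℕ.<_) (∑ᶠ-cong λ j → cong square (lookup-x j))
          (proj₂ chosen x (tabulate-∈-vecs v λ j → ∈-digits (v<p j)) inv λ i → fromWitness (hits i))
        absurd (no ¬inv) = ⊥-elim (cᵢ≢0 (latticeVec-injective p r A c v≡0 i))
          where
          y≡0 : ∀ j → message x j ≡ + 0
          y≡0 j = ∣∧∣i∣<⇒≡0
            (decidable-stable (+ p ∣? message x j) λ p∤y → ¬inv (j , p∤y))
            (subst (λ z → ∣ z ∣ ℕ.< p) (sym (lookup-x (r ↑ʳ j))) (v<p (r ↑ʳ j)))
          parity≡0 : ∀ i → v (i ↑ˡ k) ≡ + 0
          parity≡0 i = ∣∧∣i∣<⇒≡0 (subst (+ p ∣_)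
            (trans (cong₂ _-_ (lookup-x (i ↑ˡ k)) (trans
                     (sym (Σℤ-foldr λ j → message x j * A i j))
                     (Σℤ-zero λ j → cong (_* A i j) (y≡0 j))))
                   (ℤP.+-identityʳ _))
            (hits i)) (v<p (i ↑ˡ k))
          v≡0 : ∀ j → v j ≡ + 0
          v≡0 = ↑-cases r {P = λ j → v j ≡ + 0} parity≡0
            (λ j → trans (sym (lookup-x (r ↑ʳ j))) (y≡0 j))
      e<s : e ℕ.< ∑ᶠ (square ∘ v)
      e<s = decidable-stable (e ℕ.<? ∑ᶠ (square ∘ v)) λ e≮s →
        e≮s (Small.absurd (ℕP.≮⇒≥ e≮s) (involved? x))

  -- The Gram determinant is the square of `suc q ^ r`, so the last hypothesis is the density bound,
  -- squared and without denominators.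
  lattice-exists : ∀ {N m} q r k e (w : ℤ → ℕ) b W D .{{_ : NonZero b}} →
    N ≡ r ℕ.+ k → m ≡ suc e → Prime (suc q) → e ℕ.< suc q ℕ.* suc q →
    (∀ t → W ℕ.≤ w t ℕ.* b ℕ.^ square t) →
    b ℕ.^ e ℕ.* ∑ (digits q) w ℕ.^ N ℕ.< W ℕ.^ N ℕ.* suc q ℕ.^ r →
    D ℕ.* (suc q ℕ.^ r ℕ.* suc q ℕ.^ r) ℕ.≤ m ℕ.^ N →
    Σ ℕ λ n → Σ (Fin N → Fin n → ℤ) λ B → Σ ℕ λ m →
      (+ 0 < det (gram B))
      × ((c : Fin N → ℤ) → NonzeroCoeffs c → + m ≤ normSq (latticeVec B c))
      × (+ D * det (gram B) ≤ + (m ℕ.^ N))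
  lattice-exists {N} {m} q r k e w b W D refl refl p-prime e<p² W≤ small dense =
    N , B , m ,
    subst (+ 0 <_) (sym det≡) (ℤ.+<+ (ℕP.*-mono-< (ℕP.m^n>0 p r) (ℕP.m^n>0 p r))) ,
    minimum ,
    subst (_≤ + (m ℕ.^ N)) (trans (ℤP.pos-* D _) (cong (+ D *_) (sym det≡))) (ℤ.+≤+ dense)
    where
    open ConstructionA q p-prime r k e e<p² w b W W≤ small
    det≡ = det-gram-basis p r A

  -- 4096 · 8 ^ (- t²) for |t| ≤ 2, flattened beyond so as to stay integral; the density has
  -- enough slack to absorb the loss.
  theta : ℤ → ℕ
  theta (+ 0)      = 4096
  theta (+ 1)      = 512
  theta (-[1+ 0 ]) = 512
  theta _          = 1

  theta-bound : ∀ t → 4096 ℕ.≤ theta t ℕ.* 8 ℕ.^ square t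
  theta-bound (+ 0)            = ℕP.≤-refl
  theta-bound (+ 1)            = ℕP.≤-refl
  theta-bound (+ (suc (suc n))) = tail (suc (suc n)) (s≤s (s≤s z≤n))
    where
    tail : ∀ n → 2 ℕ.≤ n → 4096 ℕ.≤ 1 ℕ.* 8 ℕ.^ (n ℕ.* n)
    -- 8 ^ (2 · 2) = 4096, so weight 1 suffices from |t| = 2 on.
    tail n 2≤n = ℕP.≤-trans (ℕP.^-monoʳ-≤ 8 (ℕP.*-mono-≤ 2≤n 2≤n)) (ℕP.m≤m+n _ 0)
  theta-bound -[1+ 0 ]         = ℕP.≤-refl
  theta-bound -[1+ (suc n) ]   = theta-bound (+ (suc (suc n)))

-- The numerical parameters.

open import Data.Nat using (ℕ; _^_)
open import Data.Nat.Primality using (prime?)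
open import Data.Nat.Properties using (≤ᵇ⇒≤)
open import Data.Integer using (ℤ; +_; _*_; _≤_; _<_)
open import Data.Product using (Σ; _×_)

theorem6p1 : (Σ (Fin 772 → Fin 4096 → Bool) λ G → IsBinaryLinearCode 4096 772 1024 G)
    ×
    (Σ ℕ λ n → Σ (Fin 4096 → Fin n → ℤ) λ B → Σ ℕ λ m →
    (+ 0 < det (gram B))
    × ((c : Fin 4096 → ℤ) → NonzeroCoeffs c → + m ≤ normSq (latticeVec B c))
    × (+ (2 ^ 31250) * det (gram B) ≤ + (m ^ 4096)))
theorem6p1 =
  -- Of the 772 rows, 771 are random. Closed inequalities are checked by evaluation.
  BinaryCode.code-exists 3324 771 1023 refl refl refl (≤ᵇ⇒≤ _ _ tt) (≤ᵇ⇒≤ _ _ tt) ,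
  -- The squared center density is (m / 4) ^ 4096 / det, whence 31250 = 2 · 11529 + 2 · 4096. The
  -- value 960 = 31² - 1 is the largest possible, as the lattice contains vectors of norm 31². The
  -- `theta` weights add up to 4096 + 2 · 512 + 58 = 5178, and 861 is the least number of checks
  -- that beats 8 ^ 960 · (5178 / 4096) ^ 4096.
  Lattice.lattice-exists 30 861 3235 960 Lattice.theta 8 4096 (2 ^ 31250) refl refl
    (toWitness {a? = prime? 31} tt) (≤ᵇ⇒≤ _ _ tt) Lattice.theta-bound (≤ᵇ⇒≤ _ _ tt) (≤ᵇ⇒≤ _ _ tt)
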